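{- Let $n\ge 1$ be an integer. (1) If $a$ is a real number with $a>2$, then $\max\{B_i(a): 2^{n-1}\le i\le 2^{n}\}=a^{n}=B_{2^n}(a)$. (2) If $0<a<2$, then $$\min\{B_i(a): 2^{n-1}\le i\le 2^{n}\}=\begin{cases} a^{n} & \text{if } 0<a\le 1,\\ a^{n-1} & \text{if } 1<a<2.\end{cases}$$
   Context: The Stern polynomials $B_n(t)\in\mathbb{Z}[t]$, $n\ge 0$, are defined by $B_0(t)=0$, $B_1(t)=1$, $B_{2n}(t)=tB_n(t)$ and $B_{2n+1}(t)=B_n(t)+B_{n+1}(t)$ for $n\ge 1$. -}

module Defs where

open import Data.Integer.Base as ℤ using (ℤ)
open import Data.List.Base using (List; []; _∷_)
open import Data.Nat.Base as ℕ using (ℕ; zero; suc; ⌊_/2⌋; ⌈_/2⌉; parity)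
import Data.Nat.Properties as ℕₚ
open import Data.Nat.Induction using (<-wellFounded; <-rec)
open import Data.Nat.Solver using () renaming (module +-*-Solver to ℕ-Solver)
open import Data.Parity.Base using (Parity; 0ℙ; 1ℙ)
open import Data.Product.Base using (Σ; ∃; _×_; _,_)
open import Data.Rational.Base as ℚ using (ℚ; 0ℚ; 1ℚ; ½; ∣_∣)
import Data.Rational.Properties as ℚₚ
open import Data.Rational.Solver using () renaming (module +-*-Solver to ℚ-Solver)
open import Induction.WellFounded using (WfRec; module FixPoint)
open import Relation.Binary.PropositionalEquality
  using (_≡_; refl; sym; trans; cong; cong₂; subst; module ≡-Reasoning)

------------------------------------------------------------------------
-- Real numbers (Cantor's construction: Cauchy sequences of rationals,
-- with the equality _≃_ in place of a quotient)

Eventually : (ℕ → Set) → Set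
Eventually P = ∃ λ N → ∀ n → N ℕ.≤ n → P n

IsCauchy : (ℕ → ℚ) → Set
IsCauchy x = ∀ ε → 0ℚ ℚ.< ε →
  ∃ λ N → ∀ m n → N ℕ.≤ m → N ℕ.≤ n → ∣ x m ℚ.- x n ∣ ℚ.≤ ε

record ℝ : Set where
  constructor mkℝ
  field
    seq    : ℕ → ℚ
    cauchy : IsCauchy seq

open ℝ public

infix 4 _≃_ _≤_ _<_

_≃_ : ℝ → ℝ → Set
x ≃ y = ∀ ε → 0ℚ ℚ.< ε → Eventually λ n → ∣ seq x n ℚ.- seq y n ∣ ℚ.≤ ε

_≤_ : ℝ → ℝ → Set
x ≤ y = ∀ ε → 0ℚ ℚ.< ε → Eventually λ n → seq x n ℚ.≤ seq y n ℚ.+ ε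

-- The two sequences must be separated by a positive rational: a termwise
-- strict inequality would not respect _≃_.
_<_ : ℝ → ℝ → Set
x < y = ∃ λ ε → 0ℚ ℚ.< ε × Eventually λ n → seq x n ℚ.+ ε ℚ.≤ seq y n

private
  half-pos : ∀ {ε} → 0ℚ ℚ.< ε → 0ℚ ℚ.< ½ ℚ.* ε
  half-pos 0<ε = ℚₚ.*-monoʳ-<-pos ½ 0<ε

  halves : ∀ ε → ½ ℚ.* ε ℚ.+ ½ ℚ.* ε ≡ ε
  halves ε = trans (sym (ℚₚ.*-distribʳ-+ ε ½ ½)) (ℚₚ.*-identityˡ ε)

  const-cauchy : ∀ q → IsCauchy (λ _ → q)
  const-cauchy q ε 0<ε = 0 , λ _ _ _ _ →
    subst (ℚ._≤ ε) (cong ∣_∣ (sym (ℚₚ.+-inverseʳ q))) (ℚₚ.<⇒≤ 0<ε)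

  +-cauchy : ∀ {x y} → IsCauchy x → IsCauchy y → IsCauchy (λ n → x n ℚ.+ y n)
  +-cauchy {x} {y} cx cy ε 0<ε =
    let M , px = cx (½ ℚ.* ε) (half-pos 0<ε)
        N , py = cy (½ ℚ.* ε) (half-pos 0<ε)
    in M ℕ.⊔ N , λ m n m≥ n≥ → begin
      ∣ (x m ℚ.+ y m) ℚ.- (x n ℚ.+ y n) ∣
        ≡⟨ cong ∣_∣ (regroup (x m) (y m) (x n) (y n)) ⟩
      ∣ (x m ℚ.- x n) ℚ.+ (y m ℚ.- y n) ∣
        ≤⟨ ℚₚ.∣p+q∣≤∣p∣+∣q∣ (x m ℚ.- x n) (y m ℚ.- y n) ⟩
      ∣ x m ℚ.- x n ∣ ℚ.+ ∣ y m ℚ.- y n ∣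
        ≤⟨ ℚₚ.+-mono-≤
             (px m n (ℕₚ.m⊔n≤o⇒m≤o M N m≥) (ℕₚ.m⊔n≤o⇒m≤o M N n≥))
             (py m n (ℕₚ.m⊔n≤o⇒n≤o M N m≥) (ℕₚ.m⊔n≤o⇒n≤o M N n≥)) ⟩
      ½ ℚ.* ε ℚ.+ ½ ℚ.* ε
        ≡⟨ halves ε ⟩
      ε ∎
    where
    open ℚₚ.≤-Reasoning
    regroup : ∀ a b c d →
      (a ℚ.+ b) ℚ.- (c ℚ.+ d) ≡ (a ℚ.- c) ℚ.+ (b ℚ.- d)
    regroup = solve 4 (λ a b c d →
      (a :+ b) :- (c :+ d) := (a :- c) :+ (b :- d)) refl
      where open ℚ-Solver

  bounded : ∀ {x} → IsCauchy x →
    Σ ℚ λ K → ℚ.Positive K × Eventually λ n → ∣ x n ∣ ℚ.≤ K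
  bounded {x} cx =
    let N , p = cx 1ℚ (ℚₚ.positive⁻¹ 1ℚ)
    in ∣ x N ∣ ℚ.+ 1ℚ
     , ℚₚ.nonNeg+pos⇒pos ∣ x N ∣ {{ℚ.nonNegative (ℚₚ.0≤∣p∣ (x N))}} 1ℚ
     , N , λ n n≥ → begin
      ∣ x n ∣
        ≡⟨ cong ∣_∣ (split (x n) (x N)) ⟩
      ∣ x N ℚ.+ (x n ℚ.- x N) ∣
        ≤⟨ ℚₚ.∣p+q∣≤∣p∣+∣q∣ (x N) (x n ℚ.- x N) ⟩
      ∣ x N ∣ ℚ.+ ∣ x n ℚ.- x N ∣
        ≤⟨ ℚₚ.+-monoʳ-≤ ∣ x N ∣ (p n N n≥ ℕₚ.≤-refl) ⟩
      ∣ x N ∣ ℚ.+ 1ℚ ∎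
    where
    open ℚₚ.≤-Reasoning
    split : ∀ a b → a ≡ b ℚ.+ (a ℚ.- b)
    split = solve 2 (λ a b → a := b :+ (a :- b)) refl
      where open ℚ-Solver

  scale : ∀ K → ℚ.Positive K → ∀ ε → 0ℚ ℚ.< ε →
    ∃ λ δ → 0ℚ ℚ.< δ × K ℚ.* δ ≡ ε
  scale K K>0 ε 0<ε = 1/K ℚ.* ε , 0<δ , eq
    where
    instance
      _ = K>0
      _ = ℚₚ.pos⇒nonZero K
    1/K = ℚ.1/ K
    0<δ : 0ℚ ℚ.< 1/K ℚ.* ε
    0<δ = subst (ℚ._< 1/K ℚ.* ε) (ℚₚ.*-zeroʳ 1/K)
            (ℚₚ.*-monoʳ-<-pos 1/K {{ℚₚ.1/pos⇒pos K}} 0<ε)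
    eq : K ℚ.* (1/K ℚ.* ε) ≡ ε
    eq = trans (sym (ℚₚ.*-assoc K 1/K ε))
           (trans (cong (ℚ._* ε) (ℚₚ.*-inverseʳ K)) (ℚₚ.*-identityˡ ε))

  ∣*∣-bound : ∀ {p q K δ} → ℚ.Positive K →
    ∣ p ∣ ℚ.≤ K → ∣ q ∣ ℚ.≤ δ → ∣ p ℚ.* q ∣ ℚ.≤ K ℚ.* δ
  ∣*∣-bound {p} {q} {K} {δ} K>0 p≤ q≤ = begin
    ∣ p ℚ.* q ∣     ≡⟨ ℚₚ.∣p*q∣≡∣p∣*∣q∣ p q ⟩
    ∣ p ∣ ℚ.* ∣ q ∣ ≤⟨ ℚₚ.*-monoʳ-≤-nonNeg ∣ q ∣
                         {{ℚ.nonNegative (ℚₚ.0≤∣p∣ q)}} p≤ ⟩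
    K ℚ.* ∣ q ∣     ≤⟨ ℚₚ.*-monoˡ-≤-nonNeg K
                         {{ℚₚ.pos⇒nonNeg K {{K>0}}}} q≤ ⟩
    K ℚ.* δ         ∎
    where open ℚₚ.≤-Reasoning

  *-cauchy : ∀ {x y} → IsCauchy x → IsCauchy y → IsCauchy (λ n → x n ℚ.* y n)
  *-cauchy {x} {y} cx cy ε 0<ε =
    let K , K>0 , A , x≤K = bounded cx
        L , L>0 , B , y≤L = bounded cy
        δ , 0<δ , Kδ = scale K K>0 (½ ℚ.* ε) (half-pos 0<ε)
        η , 0<η , Lη = scale L L>0 (½ ℚ.* ε) (half-pos 0<ε)
        M , px = cx η 0<η
        N , py = cy δ 0<δ
        AB = A ℕ.⊔ B
        MN = M ℕ.⊔ N
        toA = λ {k} (k≥ : AB ℕ.⊔ MN ℕ.≤ k) →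
                ℕₚ.m⊔n≤o⇒m≤o A B (ℕₚ.m⊔n≤o⇒m≤o AB MN k≥)
        toB = λ {k} (k≥ : AB ℕ.⊔ MN ℕ.≤ k) →
                ℕₚ.m⊔n≤o⇒n≤o A B (ℕₚ.m⊔n≤o⇒m≤o AB MN k≥)
        toM = λ {k} (k≥ : AB ℕ.⊔ MN ℕ.≤ k) →
                ℕₚ.m⊔n≤o⇒m≤o M N (ℕₚ.m⊔n≤o⇒n≤o AB MN k≥)
        toN = λ {k} (k≥ : AB ℕ.⊔ MN ℕ.≤ k) →
                ℕₚ.m⊔n≤o⇒n≤o M N (ℕₚ.m⊔n≤o⇒n≤o AB MN k≥)
    in AB ℕ.⊔ MN , λ m n m≥ n≥ → begin
      ∣ x m ℚ.* y m ℚ.- x n ℚ.* y n ∣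
        ≡⟨ cong ∣_∣ (regroup (x m) (y m) (x n) (y n)) ⟩
      ∣ x m ℚ.* (y m ℚ.- y n) ℚ.+ y n ℚ.* (x m ℚ.- x n) ∣
        ≤⟨ ℚₚ.∣p+q∣≤∣p∣+∣q∣ (x m ℚ.* (y m ℚ.- y n)) (y n ℚ.* (x m ℚ.- x n)) ⟩
      ∣ x m ℚ.* (y m ℚ.- y n) ∣ ℚ.+ ∣ y n ℚ.* (x m ℚ.- x n) ∣
        ≤⟨ ℚₚ.+-mono-≤
             (∣*∣-bound {p = x m} {q = y m ℚ.- y n} K>0
               (x≤K m (toA m≥)) (py m n (toN m≥) (toN n≥)))
             (∣*∣-bound {p = y n} {q = x m ℚ.- x n} L>0
               (y≤L n (toB n≥)) (px m n (toM m≥) (toM n≥))) ⟩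
      K ℚ.* δ ℚ.+ L ℚ.* η
        ≡⟨ cong₂ ℚ._+_ Kδ Lη ⟩
      ½ ℚ.* ε ℚ.+ ½ ℚ.* ε
        ≡⟨ halves ε ⟩
      ε ∎
    where
    open ℚₚ.≤-Reasoning
    regroup : ∀ a b c d →
      a ℚ.* b ℚ.- c ℚ.* d ≡ a ℚ.* (b ℚ.- d) ℚ.+ d ℚ.* (a ℚ.- c)
    regroup = solve 4 (λ a b c d →
      a :* b :- c :* d := a :* (b :- d) :+ d :* (a :- c)) refl
      where open ℚ-Solver

infixl 6 _+_
infixl 7 _*_
infixr 8 _^_

fromℚ : ℚ → ℝ
fromℚ q = mkℝ (λ _ → q) (const-cauchy q)

fromℤ : ℤ → ℝ
fromℤ z = fromℚ (z ℚ./ 1)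

0ℝ 1ℝ 2ℝ : ℝ
0ℝ = fromℤ (ℤ.+ 0)
1ℝ = fromℤ (ℤ.+ 1)
2ℝ = fromℤ (ℤ.+ 2)

_+_ : ℝ → ℝ → ℝ
x + y = mkℝ (λ n → seq x n ℚ.+ seq y n) (+-cauchy {seq x} {seq y} (cauchy x) (cauchy y))

_*_ : ℝ → ℝ → ℝ
x * y = mkℝ (λ n → seq x n ℚ.* seq y n) (*-cauchy {seq x} {seq y} (cauchy x) (cauchy y))

_^_ : ℝ → ℕ → ℝ
x ^ zero  = 1ℝ
x ^ suc n = x * x ^ n

IsMaximum : (ℝ → Set) → ℝ → Set
IsMaximum S m = S m × (∀ x → S x → x ≤ m)

IsMinimum : (ℝ → Set) → ℝ → Set
IsMinimum S m = S m × (∀ x → S x → m ≤ x)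

------------------------------------------------------------------------
-- ℤ[t]: a polynomial is its list of coefficients, constant term first

Poly : Set
Poly = List ℤ

t·_ : Poly → Poly
t· p = ℤ.+ 0 ∷ p

infixl 6 _⊕_

_⊕_ : Poly → Poly → Poly
[]      ⊕ q       = q
p       ⊕ []      = p
(c ∷ p) ⊕ (d ∷ q) = (c ℤ.+ d) ∷ (p ⊕ q)

eval : Poly → ℝ → ℝ
eval []      x = 0ℝ
eval (c ∷ p) x = fromℤ c + x * eval p x

------------------------------------------------------------------------
-- Stern polynomials
--
-- Both recurrences express the polynomial of index n ≥ 2 through those of
-- index ⌊n/2⌋ and ⌈n/2⌉; they are proved as B-even and B-odd below.

private
  combine : Parity → Poly → Poly → Poly
  combine 0ℙ p q = t· p
  combine 1ℙ p q = p ⊕ q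

  step : ∀ n → WfRec ℕ._<_ (λ _ → Poly) n → Poly
  step 0               _   = []
  step 1               _   = ℤ.+ 1 ∷ []
  step n@(suc (suc m)) rec =
    combine (parity n) (rec (ℕₚ.⌊n/2⌋<n (suc m))) (rec (ℕₚ.⌈n/2⌉<n m))

B : ℕ → Poly
B = <-rec (λ _ → Poly) step

private
  step-ext : ∀ n {IH IH′ : WfRec ℕ._<_ (λ _ → Poly) n} →
    (∀ {m} m<n → IH {m} m<n ≡ IH′ m<n) → step n IH ≡ step n IH′
  step-ext 0               _  = refl
  step-ext 1               _  = refl
  step-ext n@(suc (suc m)) eq = cong₂ (combine (parity n)) (eq _) (eq _)

  B-unfold : ∀ m → let n = suc (suc m) in
    B n ≡ combine (parity n) (B ⌊ n /2⌋) (B ⌈ n /2⌉)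
  B-unfold m =
    FixPoint.unfold-wfRec <-wellFounded (λ _ → Poly) step step-ext {suc (suc m)}

  parity-even : ∀ n → parity (n ℕ.+ n) ≡ 0ℙ
  parity-even zero    = refl
  parity-even (suc n) rewrite ℕₚ.+-suc n n = parity-even n

  parity-odd : ∀ n → parity (suc (n ℕ.+ n)) ≡ 1ℙ
  parity-odd zero    = refl
  parity-odd (suc n) rewrite ℕₚ.+-suc n n = parity-odd n

B-0 : B 0 ≡ []
B-0 = refl

B-1 : B 1 ≡ ℤ.+ 1 ∷ []
B-1 = refl

B-even : ∀ n → 1 ℕ.≤ n → B (2 ℕ.* n) ≡ t· B n
B-even n@(suc k) _ = begin
  B (2 ℕ.* n)
    ≡⟨ cong B index ⟩
  B (2 ℕ.+ (k ℕ.+ k))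
    ≡⟨ B-unfold (k ℕ.+ k) ⟩
  combine (parity (k ℕ.+ k)) (B (suc ⌊ k ℕ.+ k /2⌋)) (B (suc ⌈ k ℕ.+ k /2⌉))
    ≡⟨ cong (λ π → combine π (B (suc ⌊ k ℕ.+ k /2⌋)) (B (suc ⌈ k ℕ.+ k /2⌉)))
         (parity-even k) ⟩
  t· B (suc ⌊ k ℕ.+ k /2⌋)
    ≡⟨ cong (λ i → t· B (suc i)) (sym (ℕₚ.n≡⌊n+n/2⌋ k)) ⟩
  t· B n ∎
  where
  open ≡-Reasoning
  index : 2 ℕ.* n ≡ 2 ℕ.+ (k ℕ.+ k)
  index = solve 1 (λ k → con 2 :* (con 1 :+ k) := con 2 :+ (k :+ k)) refl k
    where open ℕ-Solver

B-odd : ∀ n → 1 ℕ.≤ n → B (2 ℕ.* n ℕ.+ 1) ≡ B n ⊕ B (n ℕ.+ 1)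
B-odd n@(suc k) _ = begin
  B (2 ℕ.* n ℕ.+ 1)
    ≡⟨ cong B index ⟩
  B (2 ℕ.+ suc (k ℕ.+ k))
    ≡⟨ B-unfold (suc (k ℕ.+ k)) ⟩
  combine (parity (suc (k ℕ.+ k)))
    (B (suc ⌈ k ℕ.+ k /2⌉)) (B (suc (suc ⌊ k ℕ.+ k /2⌋)))
    ≡⟨ cong (λ π → combine π (B (suc ⌈ k ℕ.+ k /2⌉)) (B (suc (suc ⌊ k ℕ.+ k /2⌋))))
         (parity-odd k) ⟩
  B (suc ⌈ k ℕ.+ k /2⌉) ⊕ B (suc (suc ⌊ k ℕ.+ k /2⌋))
    ≡⟨ cong₂ (λ i j → B (suc i) ⊕ B (suc (suc j)))
         (sym (ℕₚ.n≡⌈n+n/2⌉ k)) (sym (ℕₚ.n≡⌊n+n/2⌋ k)) ⟩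
  B n ⊕ B (suc n)
    ≡⟨ cong (λ i → B n ⊕ B i) (ℕₚ.+-comm 1 n) ⟩
  B n ⊕ B (n ℕ.+ 1) ∎
  where
  open ≡-Reasoning
  index : 2 ℕ.* n ℕ.+ 1 ≡ 2 ℕ.+ suc (k ℕ.+ k)
  index = solve 1 (λ k → con 2 :* (con 1 :+ k) :+ con 1
                         := con 2 :+ (con 1 :+ (k :+ k))) refl k
    where open ℕ-Solver

SternValues : ℕ → ℝ → ℝ → Set
SternValues n a x =
  ∃ λ i → 2 ℕ.^ (n ℕ.∸ 1) ℕ.≤ i × i ℕ.≤ 2 ℕ.^ n × x ≃ eval (B i) a

{-# OPTIONS --safe #-}

-- The values at the powers of two are B (2 ^ k) (a) = a ^ k.  The remaining
-- values are compared with a geometric progression b k of ratio a (a ^ (k + 1)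
-- or a ^ k) by induction on the dyadic block [2 ^ k , 2 ^ (k + 1)]: an even
-- index multiplies the bound of the previous block by a, an odd index doubles
-- it, and b k + b k is on the right side of b (k + 1) = a b k according to the
-- sign of a - 2.  Upper and lower bounds are the same argument for opposite
-- preorders.
module Submission where

open import Defs
open import Data.Integer.Base as ℤ using ()
import Data.Integer.Properties as ℤₚ
open import Data.List.Base using ([]; _∷_)
open import Data.Nat.Base as ℕ using (ℕ; zero; suc; s≤s)
import Data.Nat.Properties as ℕₚ
open import Data.Product.Base using (∃; _×_; _,_)
open import Data.Rational.Base as ℚ using (0ℚ; 1ℚ; ½; ∣_∣)
import Data.Rational.Properties as ℚₚ
import Data.Rational.Unnormalised.Base as ℚᵘ
import Data.Rational.Unnormalised.Properties as ℚᵘₚ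
open import Data.Rational.Solver using () renaming (module +-*-Solver to ℚ-Solver)
open import Data.Sum.Base using (_⊎_; inj₁; inj₂)
open import Function.Base using (flip)
open import Relation.Binary.PropositionalEquality
  using (_≡_; refl; sym; trans; cong; cong₂; subst; module ≡-Reasoning)

-- Eventual properties and rational estimates

eventually₂ : {P Q R : ℕ → Set} → (∀ {n} → P n → Q n → R n) →
  Eventually P → Eventually Q → Eventually R
eventually₂ f (M , p) (N , q) = M ℕ.⊔ N , λ n n≥ →
  f (p n (ℕₚ.m⊔n≤o⇒m≤o M N n≥)) (q n (ℕₚ.m⊔n≤o⇒n≤o M N n≥))

eventually : {P Q : ℕ → Set} → (∀ {n} → P n → Q n) → Eventually P → Eventually Q
eventually f (N , p) = N , λ n n≥ → f (p n n≥)

halving : ∀ {ε} → 0ℚ ℚ.< ε → ∃ λ δ → 0ℚ ℚ.< δ × δ ℚ.+ δ ≡ ε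
halving {ε} 0<ε = ½ ℚ.* ε , ℚₚ.*-monoʳ-<-pos ½ 0<ε
  , trans (sym (ℚₚ.*-distribʳ-+ ε ½ ½)) (ℚₚ.*-identityˡ ε)

dividing : ∀ K → 0ℚ ℚ.< K → ∀ {ε} → 0ℚ ℚ.< ε → ∃ λ δ → 0ℚ ℚ.< δ × K ℚ.* δ ≡ ε
dividing K 0<K {ε} 0<ε = 1/K ℚ.* ε
  , subst (ℚ._< 1/K ℚ.* ε) (ℚₚ.*-zeroʳ 1/K) (ℚₚ.*-monoʳ-<-pos 1/K {{ℚₚ.1/pos⇒pos K}} 0<ε)
  , trans (sym (ℚₚ.*-assoc K 1/K ε))
      (trans (cong (ℚ._* ε) (ℚₚ.*-inverseʳ K)) (ℚₚ.*-identityˡ ε))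
  where
  instance
    _ = ℚ.positive 0<K
    _ = ℚₚ.pos⇒nonZero K
  1/K = ℚ.1/ K

p≤∣p∣ : ∀ p → p ℚ.≤ ∣ p ∣
p≤∣p∣ p with ℚₚ.≤-total 0ℚ p
... | inj₁ 0≤p = ℚₚ.≤-reflexive (sym (ℚₚ.0≤p⇒∣p∣≡p 0≤p))
... | inj₂ p≤0 = ℚₚ.≤-trans p≤0 (ℚₚ.0≤∣p∣ p)

∣p-q∣≤ε⇒p≤q+ε : ∀ p q {ε} → ∣ p ℚ.- q ∣ ℚ.≤ ε → p ℚ.≤ q ℚ.+ ε
∣p-q∣≤ε⇒p≤q+ε p q {ε} h = begin
  p                       ≡⟨ solve 2 (λ p q → p := q :+ (p :- q)) refl p q ⟩
  q ℚ.+ (p ℚ.- q)         ≤⟨ ℚₚ.+-monoʳ-≤ q (ℚₚ.≤-trans (p≤∣p∣ (p ℚ.- q)) h) ⟩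
  q ℚ.+ ε                 ∎
  where
  open ℚₚ.≤-Reasoning
  open ℚ-Solver

∣p-q∣≤ε⇒q≤p+ε : ∀ p q {ε} → ∣ p ℚ.- q ∣ ℚ.≤ ε → q ℚ.≤ p ℚ.+ ε
∣p-q∣≤ε⇒q≤p+ε p q {ε} h = ∣p-q∣≤ε⇒p≤q+ε q p (subst (ℚ._≤ ε) flipped h)
  where
  open ℚ-Solver
  flipped : ∣ p ℚ.- q ∣ ≡ ∣ q ℚ.- p ∣
  flipped = trans (sym (ℚₚ.∣-p∣≡∣p∣ (p ℚ.- q)))
    (cong ∣_∣ (solve 2 (λ p q → :- (p :- q) := q :- p) refl p q))

p≤p+ε : ∀ p {ε} → 0ℚ ℚ.< ε → p ℚ.≤ p ℚ.+ ε
p≤p+ε p {ε} 0<ε = subst (ℚ._≤ p ℚ.+ ε) (ℚₚ.+-identityʳ p) (ℚₚ.+-monoʳ-≤ p (ℚₚ.<⇒≤ 0<ε))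

-- Order on the reals

infix 4 _≈_ _≼_

-- The relations are wrapped in records so that the reals they relate can be
-- inferred: _≃_ and _≤_ unfold to statements about the sequences alone.
record _≈_ (x y : ℝ) : Set where
  constructor pointwise
  field at : ∀ n → seq x n ≡ seq y n

open _≈_

record _≼_ (x y : ℝ) : Set where
  constructor wrap
  field unwrap : x ≤ y

open _≼_

≈-sym : ∀ {x y} → x ≈ y → y ≈ x
≈-sym h .at n = sym (h .at n)

≈⇒≃ : ∀ {x y} → x ≈ y → x ≃ y
≈⇒≃ {x} {y} h ε 0<ε = 0 , λ n _ → begin
  ∣ seq x n ℚ.- seq y n ∣ ≡⟨ cong (λ p → ∣ p ℚ.- seq y n ∣) (h .at n) ⟩
  ∣ seq y n ℚ.- seq y n ∣ ≡⟨ cong ∣_∣ (ℚₚ.+-inverseʳ (seq y n)) ⟩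
  0ℚ                      ≤⟨ ℚₚ.<⇒≤ 0<ε ⟩
  ε                       ∎
  where open ℚₚ.≤-Reasoning

≃⇒≼ : ∀ x y → x ≃ y → x ≼ y
≃⇒≼ x y h .unwrap ε 0<ε = eventually (λ {n} → ∣p-q∣≤ε⇒p≤q+ε (seq x n) (seq y n)) (h ε 0<ε)

≃⇒≽ : ∀ x y → x ≃ y → y ≼ x
≃⇒≽ x y h .unwrap ε 0<ε = eventually (λ {n} → ∣p-q∣≤ε⇒q≤p+ε (seq x n) (seq y n)) (h ε 0<ε)

≈⇒≼ : ∀ {x y} → x ≈ y → x ≼ y
≈⇒≼ {x} {y} h = ≃⇒≼ x y (≈⇒≃ h)

≼-refl : ∀ {x} → x ≼ x
≼-refl = ≈⇒≼ (pointwise λ _ → refl)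

<⇒≼ : ∀ x y → x < y → x ≼ y
<⇒≼ x y (δ , 0<δ , h) .unwrap ε 0<ε = eventually
  (λ {n} p → ℚₚ.≤-trans (p≤p+ε (seq x n) 0<δ) (ℚₚ.≤-trans p (p≤p+ε (seq y n) 0<ε))) h

≼-trans : ∀ {x y z} → x ≼ y → y ≼ z → x ≼ z
≼-trans {x} {y} {z} x≼y y≼z .unwrap ε 0<ε with halving 0<ε
-- Each hypothesis gets half of the tolerance; matching on `refl` replaces `ε` by `δ + δ`.
... | δ , 0<δ , refl = eventually₂ chain (x≼y .unwrap δ 0<δ) (y≼z .unwrap δ 0<δ)
  where
  open ℚₚ.≤-Reasoning
  chain : ∀ {n} → seq x n ℚ.≤ seq y n ℚ.+ δ → seq y n ℚ.≤ seq z n ℚ.+ δ →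
    seq x n ℚ.≤ seq z n ℚ.+ (δ ℚ.+ δ)
  chain {n} p q = begin
    seq x n                   ≤⟨ p ⟩
    seq y n ℚ.+ δ             ≤⟨ ℚₚ.+-monoˡ-≤ δ q ⟩
    (seq z n ℚ.+ δ) ℚ.+ δ     ≡⟨ ℚₚ.+-assoc (seq z n) δ δ ⟩
    seq z n ℚ.+ (δ ℚ.+ δ)     ∎

+-mono-≼ : ∀ x y u v → x ≼ y → u ≼ v → (x + u) ≼ (y + v)
+-mono-≼ x y u v x≼y u≼v .unwrap ε 0<ε with halving 0<ε
... | δ , 0<δ , refl = eventually₂ add (x≼y .unwrap δ 0<δ) (u≼v .unwrap δ 0<δ)
  where
  open ℚₚ.≤-Reasoning
  open ℚ-Solver
  add : ∀ {n} → seq x n ℚ.≤ seq y n ℚ.+ δ → seq u n ℚ.≤ seq v n ℚ.+ δ →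
    seq x n ℚ.+ seq u n ℚ.≤ (seq y n ℚ.+ seq v n) ℚ.+ (δ ℚ.+ δ)
  add {n} p q = begin
    seq x n ℚ.+ seq u n                     ≤⟨ ℚₚ.+-mono-≤ p q ⟩
    (seq y n ℚ.+ δ) ℚ.+ (seq v n ℚ.+ δ)
      ≡⟨ solve 3 (λ y v δ → (y :+ δ) :+ (v :+ δ) := (y :+ v) :+ (δ :+ δ)) refl
           (seq y n) (seq v n) δ ⟩
    (seq y n ℚ.+ seq v n) ℚ.+ (δ ℚ.+ δ)     ∎

-- From the Cauchy index for tolerance 1 on, every term stays within 1 of `seq x N`.
eventually-bounded : ∀ x → ∃ λ K → 0ℚ ℚ.< K × Eventually λ n → seq x n ℚ.≤ K
eventually-bounded x with cauchy x 1ℚ (ℚₚ.positive⁻¹ 1ℚ)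
... | N , p = ∣ seq x N ∣ ℚ.+ 1ℚ
  , ℚₚ.+-mono-≤-< (ℚₚ.0≤∣p∣ (seq x N)) (ℚₚ.positive⁻¹ 1ℚ)
  , N , λ n n≥ → ℚₚ.≤-trans (∣p-q∣≤ε⇒p≤q+ε (seq x n) (seq x N) (p n N n≥ ℕₚ.≤-refl))
                   (ℚₚ.+-monoˡ-≤ 1ℚ (p≤∣p∣ (seq x N)))

-- A condition on the representing sequence, stronger than `0ℝ ≤ x`, which still allows slightly
-- negative terms. Termwise multiplication of inequalities needs the actual sign of the factor.
EventuallyNonNeg : ℝ → Set
EventuallyNonNeg x = Eventually λ n → 0ℚ ℚ.≤ seq x n

fromℚ<⇒eventuallyNonNeg : ∀ {q} → 0ℚ ℚ.≤ q → ∀ x → fromℚ q < x → EventuallyNonNeg x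
fromℚ<⇒eventuallyNonNeg {q} 0≤q x (ε , 0<ε , h) =
  eventually (ℚₚ.≤-trans (ℚₚ.≤-trans 0≤q (p≤p+ε q 0<ε))) h

*-eventuallyNonNeg : ∀ x y →
  EventuallyNonNeg x → EventuallyNonNeg y → EventuallyNonNeg (x * y)
*-eventuallyNonNeg x y = eventually₂ λ {n} p q →
  subst (ℚ._≤ seq x n ℚ.* seq y n) (ℚₚ.*-zeroʳ (seq x n))
    (ℚₚ.*-monoˡ-≤-nonNeg (seq x n) {{ℚ.nonNegative p}} q)

^-eventuallyNonNeg : ∀ x → EventuallyNonNeg x → ∀ n → EventuallyNonNeg (x ^ n)
^-eventuallyNonNeg x x≥0 zero    = 0 , λ _ _ → ℚₚ.nonNegative⁻¹ 1ℚ
^-eventuallyNonNeg x x≥0 (suc n) =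
  *-eventuallyNonNeg x (x ^ n) x≥0 (^-eventuallyNonNeg x x≥0 n)

*-scale-≤ : ∀ {p q r K δ} → 0ℚ ℚ.≤ p → p ℚ.≤ K → 0ℚ ℚ.≤ δ → q ℚ.≤ r ℚ.+ δ →
  p ℚ.* q ℚ.≤ p ℚ.* r ℚ.+ K ℚ.* δ
*-scale-≤ {p} {q} {r} {K} {δ} 0≤p p≤K 0≤δ q≤r+δ = begin
  p ℚ.* q                   ≤⟨ ℚₚ.*-monoˡ-≤-nonNeg p {{ℚ.nonNegative 0≤p}} q≤r+δ ⟩
  p ℚ.* (r ℚ.+ δ)           ≡⟨ ℚₚ.*-distribˡ-+ p r δ ⟩
  p ℚ.* r ℚ.+ p ℚ.* δ
    ≤⟨ ℚₚ.+-monoʳ-≤ (p ℚ.* r) (ℚₚ.*-monoʳ-≤-nonNeg δ {{ℚ.nonNegative 0≤δ}} p≤K) ⟩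
  p ℚ.* r ℚ.+ K ℚ.* δ       ∎
  where open ℚₚ.≤-Reasoning

-- Multiplying by a term of `z` enlarges the error `δ` at most by the eventual bound `K`, so `δ` is
-- chosen with `K * δ ≡ ε`.
*-monoʳ-≼ : ∀ z → EventuallyNonNeg z → ∀ x y → x ≼ y → (z * x) ≼ (z * y)
*-monoʳ-≼ z z≥0 x y x≼y .unwrap ε 0<ε =
  let K , 0<K , z≤K  = eventually-bounded z
      δ , 0<δ , Kδ≡ε = dividing K 0<K 0<ε
  in eventually₂
       (λ {n} (0≤zₙ , zₙ≤K) xₙ≤yₙ+δ →
         subst (λ e → seq z n ℚ.* seq x n ℚ.≤ seq z n ℚ.* seq y n ℚ.+ e) Kδ≡ε
           (*-scale-≤ {seq z n} {seq x n} {seq y n} {K} {δ}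
             0≤zₙ zₙ≤K (ℚₚ.<⇒≤ 0<δ) xₙ≤yₙ+δ))
       (eventually₂ {R = λ n → 0ℚ ℚ.≤ seq z n × seq z n ℚ.≤ K} _,_ z≥0 z≤K)
       (x≼y .unwrap δ 0<δ)

*-comm : ∀ x y → x * y ≈ y * x
*-comm x y .at n = ℚₚ.*-comm (seq x n) (seq y n)

^-identityʳ : ∀ x → x ^ 1 ≈ x
^-identityʳ x .at n = ℚₚ.*-identityʳ (seq x n)

x*2≈x+x : ∀ x → x * 2ℝ ≈ x + x
x*2≈x+x x .at n =
  trans (ℚₚ.*-distribˡ-+ p 1ℚ 1ℚ) (cong₂ ℚ._+_ (ℚₚ.*-identityʳ p) (ℚₚ.*-identityʳ p))
  where p = seq x n

1≼2 : 1ℝ ≼ 2ℝ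
1≼2 .unwrap ε 0<ε = 0 , λ _ _ →
  ℚₚ.≤-trans (p≤p+ε 1ℚ (ℚₚ.positive⁻¹ 1ℚ)) (p≤p+ε (1ℚ ℚ.+ 1ℚ) 0<ε)

2≼x⇒doubling : ∀ x z → EventuallyNonNeg z → 2ℝ ≼ x → (z + z) ≼ (x * z)
2≼x⇒doubling x z z≥0 2≼x = ≼-trans (≈⇒≼ (≈-sym (x*2≈x+x z)))
  (≼-trans (*-monoʳ-≼ z z≥0 2ℝ x 2≼x) (≈⇒≼ (*-comm z x)))

x≼2⇒doubling : ∀ x z → EventuallyNonNeg z → x ≼ 2ℝ → (x * z) ≼ (z + z)
x≼2⇒doubling x z z≥0 x≼2 = ≼-trans (≈⇒≼ (*-comm x z))
  (≼-trans (*-monoʳ-≼ z z≥0 x 2ℝ x≼2) (≈⇒≼ (x*2≈x+x z)))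

-- Evaluation of Stern polynomials

-- The operation `/ 1` passes through gcd normalisation, so the identity is checked among
-- unnormalised rationals, where both sides have denominator 1.
fromℤ-+ : ∀ c d → (c ℤ.+ d) ℚ./ 1 ≡ c ℚ./ 1 ℚ.+ d ℚ./ 1
fromℤ-+ c d = ℚₚ.toℚᵘ-injective (begin
  ℚ.toℚᵘ ((c ℤ.+ d) ℚ./ 1)
    ≈⟨ ℚₚ.toℚᵘ-fromℚᵘ (ℚᵘ.mkℚᵘ (c ℤ.+ d) 0) ⟩
  ℚᵘ.mkℚᵘ (c ℤ.+ d) 0
    ≡⟨ cong (λ e → ℚᵘ.mkℚᵘ e 0)
         (cong₂ ℤ._+_ (sym (ℤₚ.*-identityʳ c)) (sym (ℤₚ.*-identityʳ d))) ⟩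
  ℚᵘ.mkℚᵘ c 0 ℚᵘ.+ ℚᵘ.mkℚᵘ d 0
    ≈⟨ ℚᵘₚ.+-cong (ℚₚ.toℚᵘ-fromℚᵘ (ℚᵘ.mkℚᵘ c 0)) (ℚₚ.toℚᵘ-fromℚᵘ (ℚᵘ.mkℚᵘ d 0)) ⟨
  ℚ.toℚᵘ (c ℚ./ 1) ℚᵘ.+ ℚ.toℚᵘ (d ℚ./ 1)
    ≈⟨ ℚₚ.toℚᵘ-homo-+ (c ℚ./ 1) (d ℚ./ 1) ⟨
  ℚ.toℚᵘ (c ℚ./ 1 ℚ.+ d ℚ./ 1) ∎)
  where open ℚᵘₚ.≃-Reasoning

eval-⊕ : ∀ p q x → eval (p ⊕ q) x ≈ eval p x + eval q x
eval-⊕ []      q       x .at n = sym (ℚₚ.+-identityˡ _)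
eval-⊕ (c ∷ p) []      x .at n = sym (ℚₚ.+-identityʳ _)
eval-⊕ (c ∷ p) (d ∷ q) x .at n = begin
  (c ℤ.+ d) ℚ./ 1 ℚ.+ t ℚ.* seq (eval (p ⊕ q) x) n
    ≡⟨ cong₂ (λ e r → e ℚ.+ t ℚ.* r) (fromℤ-+ c d) (eval-⊕ p q x .at n) ⟩
  (c ℚ./ 1 ℚ.+ d ℚ./ 1) ℚ.+ t ℚ.* (seq (eval p x) n ℚ.+ seq (eval q x) n)
    ≡⟨ solve 5 (λ c d t p q → (c :+ d) :+ t :* (p :+ q) := (c :+ t :* p) :+ (d :+ t :* q))
         refl (c ℚ./ 1) (d ℚ./ 1) t (seq (eval p x) n) (seq (eval q x) n) ⟩
  (c ℚ./ 1 ℚ.+ t ℚ.* seq (eval p x) n) ℚ.+ (d ℚ./ 1 ℚ.+ t ℚ.* seq (eval q x) n) ∎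
  where
  open ≡-Reasoning
  open ℚ-Solver
  t = seq x n

eval-t· : ∀ p x → eval (t· p) x ≈ x * eval p x
eval-t· p x .at n = ℚₚ.+-identityˡ _

eval-B-1 : ∀ x → eval (B 1) x ≈ 1ℝ
eval-B-1 x .at n = trans (cong (1ℚ ℚ.+_) (ℚₚ.*-zeroʳ (seq x n))) (ℚₚ.+-identityʳ 1ℚ)

eval-B-even : ∀ m → 1 ℕ.≤ m → ∀ x → eval (B (2 ℕ.* m)) x ≈ x * eval (B m) x
eval-B-even m 1≤m x =
  subst (λ p → eval p x ≈ x * eval (B m) x) (sym (B-even m 1≤m)) (eval-t· (B m) x)

eval-B-odd : ∀ m → 1 ℕ.≤ m → ∀ x →
  eval (B (2 ℕ.* m ℕ.+ 1)) x ≈ eval (B m) x + eval (B (m ℕ.+ 1)) x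
eval-B-odd m 1≤m x =
  subst (λ p → eval p x ≈ eval (B m) x + eval (B (m ℕ.+ 1)) x) (sym (B-odd m 1≤m))
    (eval-⊕ (B m) (B (m ℕ.+ 1)) x)

eval-B-2^ : ∀ k x → eval (B (2 ℕ.^ k)) x ≈ x ^ k
eval-B-2^ zero    x = eval-B-1 x
eval-B-2^ (suc k) x .at n = trans (eval-B-even (2 ℕ.^ k) (ℕₚ.m^n>0 2 k) x .at n)
  (cong (seq x n ℚ.*_) (eval-B-2^ k x .at n))

-- Value at the right end of the first block `[1, 2]`, used to start the induction.
eval-B-2 : ∀ x → eval (B 2) x ≈ x
eval-B-2 x .at n = trans (eval-B-even 1 ℕₚ.≤-refl x .at n)
  (trans (cong (seq x n ℚ.*_) (eval-B-1 x .at n)) (ℚₚ.*-identityʳ (seq x n)))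

-- Halving the indices of a block

even⊎odd : ∀ i → ∃ λ m → i ≡ 2 ℕ.* m ⊎ i ≡ 2 ℕ.* m ℕ.+ 1
even⊎odd zero = 0 , inj₁ refl
even⊎odd (suc i) with even⊎odd i
... | m , inj₁ refl = m , inj₂ (ℕₚ.+-comm 1 (2 ℕ.* m))
... | m , inj₂ refl = suc m , inj₁
  (trans (cong suc (ℕₚ.+-comm (2 ℕ.* m) 1)) (sym (ℕₚ.*-suc 2 m)))

2p≤2m+1⇒p≤m : ∀ p m → 2 ℕ.* p ℕ.≤ 2 ℕ.* m ℕ.+ 1 → p ℕ.≤ m
2p≤2m+1⇒p≤m p m h = ℕₚ.≤-pred (ℕₚ.*-cancelˡ-< 2 p (suc m) (begin-strict
  2 ℕ.* p        ≤⟨ h ⟩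
  2 ℕ.* m ℕ.+ 1  <⟨ ℕₚ.+-monoʳ-< (2 ℕ.* m) (ℕₚ.n<1+n 1) ⟩
  2 ℕ.* m ℕ.+ 2  ≡⟨ ℕₚ.+-comm (2 ℕ.* m) 2 ⟩
  2 ℕ.+ 2 ℕ.* m  ≡⟨ ℕₚ.*-suc 2 m ⟨
  2 ℕ.* suc m    ∎))
  where open ℕₚ.≤-Reasoning

2m+1≤2q⇒m+1≤q : ∀ m q → 2 ℕ.* m ℕ.+ 1 ℕ.≤ 2 ℕ.* q → m ℕ.+ 1 ℕ.≤ q
2m+1≤2q⇒m+1≤q m q h = subst (ℕ._≤ q) (ℕₚ.+-comm 1 m)
  (ℕₚ.*-cancelˡ-< 2 m q (subst (ℕ._≤ 2 ℕ.* q) (ℕₚ.+-comm (2 ℕ.* m) 1) h))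

-- The block is closed at both ends: for odd `i` the bounds on `2m + 1` round to `p ≤ m` and
-- `m + 1 ≤ q`, so both indices in the odd recurrence lie in the halved block.
halve-block : ∀ p q i → 2 ℕ.* p ℕ.≤ i → i ℕ.≤ 2 ℕ.* q → ∃ λ m → p ℕ.≤ m ×
  ((i ≡ 2 ℕ.* m × m ℕ.≤ q) ⊎ (i ≡ 2 ℕ.* m ℕ.+ 1 × m ℕ.+ 1 ℕ.≤ q))
halve-block p q i lo hi with even⊎odd i
... | m , inj₁ eq = m , ℕₚ.*-cancelˡ-≤ {p} {m} 2 (subst (2 ℕ.* p ℕ.≤_) eq lo)
  , inj₁ (eq , ℕₚ.*-cancelˡ-≤ {m} {q} 2 (subst (ℕ._≤ 2 ℕ.* q) eq hi))
... | m , inj₂ eq = m , 2p≤2m+1⇒p≤m p m (subst (2 ℕ.* p ℕ.≤_) eq lo)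
  , inj₂ (eq , 2m+1≤2q⇒m+1≤q m q (subst (ℕ._≤ 2 ℕ.* q) eq hi))

-- Induction over dyadic blocks

module _
  (_≲_ : ℝ → ℝ → Set)
  (≲-reflexive : ∀ {x y} → x ≈ y → x ≲ y)
  (≲-trans : ∀ {x y z} → x ≲ y → y ≲ z → x ≲ z)
  (+-mono-≲ : ∀ x y u v → x ≲ y → u ≲ v → (x + u) ≲ (y + v))
  (a : ℝ)
  (v : ℕ → ℝ)
  (v-1 : v 1 ≈ 1ℝ)
  (v-2 : v 2 ≈ a)
  (v-even : ∀ m → 1 ℕ.≤ m → v (2 ℕ.* m) ≈ a * v m)
  (v-odd : ∀ m → 1 ℕ.≤ m → v (2 ℕ.* m ℕ.+ 1) ≈ v m + v (m ℕ.+ 1))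
  (a*-mono-≲ : ∀ x y → x ≲ y → (a * x) ≲ (a * y))
  (b : ℕ → ℝ)
  (b₀≲1 : b 0 ≲ 1ℝ)
  (b₀≲a : b 0 ≲ a)
  (b-ratio : ∀ k → b (suc k) ≲ (a * b k))
  (b-double : ∀ k → b (suc k) ≲ (b k + b k))
  where

  -- The index `i` is quantified inside the induction on `k`, since an odd index calls on the
  -- previous block at two places.
  dyadic-block-bound : ∀ k i → 2 ℕ.^ k ℕ.≤ i → i ℕ.≤ 2 ℕ.^ suc k → b k ≲ v i
  -- The first block consists of the indices 1 and 2, with values 1 and `a`.
  dyadic-block-bound zero 1 _ _ = ≲-trans b₀≲1 (≲-reflexive (≈-sym v-1))
  dyadic-block-bound zero 2 _ _ = ≲-trans b₀≲a (≲-reflexive (≈-sym v-2))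
  dyadic-block-bound zero (suc (suc (suc _))) _ (s≤s (s≤s ()))
  dyadic-block-bound (suc k) i lo hi = from-half (halve-block (2 ℕ.^ k) (2 ℕ.^ suc k) i lo hi)
    where
    -- A with-abstraction would normalise the real arithmetic in the types.
    from-half : (∃ λ m → 2 ℕ.^ k ℕ.≤ m ×
      ((i ≡ 2 ℕ.* m × m ℕ.≤ 2 ℕ.^ suc k) ⊎ (i ≡ 2 ℕ.* m ℕ.+ 1 × m ℕ.+ 1 ℕ.≤ 2 ℕ.^ suc k))) →
      b (suc k) ≲ v i
    from-half (m , 2^k≤m , inj₁ (refl , m≤2^[1+k])) =
      ≲-trans (b-ratio k) (≲-trans
        (a*-mono-≲ (b k) (v m) (dyadic-block-bound k m 2^k≤m m≤2^[1+k]))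
        (≲-reflexive (≈-sym (v-even m (ℕₚ.≤-trans (ℕₚ.m^n>0 2 k) 2^k≤m)))))
    from-half (m , 2^k≤m , inj₂ (refl , m+1≤2^[1+k])) =
      ≲-trans (b-double k) (≲-trans
        (+-mono-≲ (b k) (v m) (b k) (v (m ℕ.+ 1))
          (dyadic-block-bound k m 2^k≤m (ℕₚ.m+n≤o⇒m≤o m m+1≤2^[1+k]))
          (dyadic-block-bound k (m ℕ.+ 1) (ℕₚ.m≤n⇒m≤n+o 1 2^k≤m) m+1≤2^[1+k]))
        (≲-reflexive (≈-sym (v-odd m (ℕₚ.≤-trans (ℕₚ.m^n>0 2 k) 2^k≤m)))))

-- Extreme values on a block

theorem2p7 : (n : ℕ) → 1 ℕ.≤ n → (a : ℝ) →
    (2ℝ < a →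
    IsMaximum (SternValues n a) (a ^ n) × a ^ n ≃ eval (B (2 ℕ.^ n)) a)
    ×
    (0ℝ < a → a < 2ℝ →
    (a ≤ 1ℝ → IsMinimum (SternValues n a) (a ^ n))
    ×
    (1ℝ < a → IsMinimum (SternValues n a) (a ^ (n ℕ.∸ 1))))
theorem2p7 n@(suc k) _ a = (λ 2<a → (a^n∈values , ≤a^n 2<a) , a^j≃B n)
  , λ 0<a a<2 → (λ a≤1 → a^n∈values , a^n≤ 0<a a<2 a≤1)
              , (λ 1<a → a^k∈values , a^k≤ 0<a a<2 1<a)
  where
  a^j≃B : ∀ j → a ^ j ≃ eval (B (2 ℕ.^ j)) a
  a^j≃B j = ≈⇒≃ (≈-sym (eval-B-2^ j a))

  2^k≤2^n : 2 ℕ.^ k ℕ.≤ 2 ℕ.^ n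
  2^k≤2^n = ℕₚ.^-monoʳ-≤ 2 (ℕₚ.n≤1+n k)

  a^n∈values : SternValues n a (a ^ n)
  a^n∈values = 2 ℕ.^ n , 2^k≤2^n , ℕₚ.≤-refl , a^j≃B n

  a^k∈values : SternValues n a (a ^ k)
  a^k∈values = 2 ℕ.^ k , ℕₚ.≤-refl , 2^k≤2^n , a^j≃B k

  ≤a^n : 2ℝ < a → ∀ x → SternValues n a x → x ≤ a ^ n
  ≤a^n 2<a x (i , lo , hi , x≃) = unwrap (≼-trans (≃⇒≼ x (eval (B i) a) x≃)
    (dyadic-block-bound (flip _≼_)
      -- Under the reversed order the bound lies above the values, so every order hypothesis is
      -- passed with its arguments exchanged.
      (λ x≈y → ≈⇒≼ (≈-sym x≈y)) (flip ≼-trans) (λ x y u v → +-mono-≼ y x v u)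
      a (λ i → eval (B i) a)
      (eval-B-1 a) (eval-B-2 a)
      (λ m 1≤m → eval-B-even m 1≤m a) (λ m 1≤m → eval-B-odd m 1≤m a)
      -- The progression starts at `a ^ 1`, the larger of the values 1 and `a` on the first block,
      -- and reaches `a ^ n` at step `k`.
      (λ x y → *-monoʳ-≼ a a≥0 y x) (λ j → a ^ suc j)
      (≼-trans 1≼2 (≼-trans 2≼a a≼a^1)) a≼a^1
      (λ _ → ≼-refl)
      (λ j → 2≼x⇒doubling a (a ^ suc j) (^-eventuallyNonNeg a a≥0 (suc j)) 2≼a)
      k i lo hi))
    where
    2≼a : 2ℝ ≼ a
    2≼a = <⇒≼ 2ℝ a 2<a
    a≥0 : EventuallyNonNeg a
    a≥0 = fromℚ<⇒eventuallyNonNeg (ℚₚ.nonNegative⁻¹ (ℤ.+ 2 ℚ./ 1)) a 2<a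
    a≼a^1 : a ≼ a ^ 1
    a≼a^1 = ≈⇒≼ (≈-sym (^-identityʳ a))

  module _ (0<a : 0ℝ < a) (a<2 : a < 2ℝ) where

    a≥0 : EventuallyNonNeg a
    a≥0 = fromℚ<⇒eventuallyNonNeg ℚₚ.≤-refl a 0<a

    -- The start `a ^ e` must lie below both values 1 and `a` of the first block: `e = 1` serves for
    -- `a ≤ 1` and `e = 0` for `1 < a`. With `e` as the right summand, `a ^ (suc j + e)` unfolds to
    -- `a * a ^ (j + e)`, so the ratio condition is reflexivity.
    lower-bound : ∀ e → a ^ e ≼ 1ℝ → a ^ e ≼ a →
      ∀ x → SternValues n a x → a ^ (k ℕ.+ e) ≤ x
    lower-bound e a^e≼1 a^e≼a x (i , lo , hi , x≃) = unwrap (≼-trans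
      (dyadic-block-bound _≼_ ≈⇒≼ ≼-trans +-mono-≼
        a (λ i → eval (B i) a)
        (eval-B-1 a) (eval-B-2 a)
        (λ m 1≤m → eval-B-even m 1≤m a) (λ m 1≤m → eval-B-odd m 1≤m a)
        (*-monoʳ-≼ a a≥0) (λ j → a ^ (j ℕ.+ e))
        a^e≼1 a^e≼a
        (λ _ → ≼-refl)
        (λ j → x≼2⇒doubling a (a ^ (j ℕ.+ e)) (^-eventuallyNonNeg a a≥0 (j ℕ.+ e)) (<⇒≼ a 2ℝ a<2))
        k i lo hi)
      (≃⇒≽ x (eval (B i) a) x≃))

    a^n≤ : a ≤ 1ℝ → ∀ x → SternValues n a x → a ^ n ≤ x
    -- The bound arrives with exponent `k + 1`, which has to be turned into `suc k`.
    a^n≤ a≤1 x x∈ = subst (λ e → a ^ e ≤ x) (ℕₚ.+-comm k 1)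
      (lower-bound 1 (≼-trans a^1≼a (wrap a≤1)) a^1≼a x x∈)
      where
      a^1≼a : a ^ 1 ≼ a
      a^1≼a = ≈⇒≼ (^-identityʳ a)

    a^k≤ : 1ℝ < a → ∀ x → SternValues n a x → a ^ k ≤ x
    a^k≤ 1<a x x∈ = subst (λ e → a ^ e ≤ x) (ℕₚ.+-identityʳ k)
      (lower-bound 0 ≼-refl (<⇒≼ 1ℝ a 1<a) x x∈)
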